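{- Let $G$ be a connected uniquely colorable graph with $\chi(G)=t\ge 3$. Then $sn(G)=t-1$.
   Context: Graphs are finite, undirected and simple. A graph $G$ with chromatic number $k$ is uniquely colorable if every proper $k$-coloring of $G$ induces the same partition of the vertex set into color classes (i.e. the partition is unique up to permutation of the colors). Let $G=(V,E)$ be a connected graph with chromatic number $\chi(G)=k\ge 2$. For $S\subset V$, a partial coloring on $G[S]$ is a proper coloring $\mathscr C_0$ of the induced subgraph $G[S]$ with colors from $\{1,\dots,k\}$ (not all colors need be used). It is a Sudoku coloring of $G$ if there is exactly one proper $k$-coloring $V\to\{1,\dots,k\}$ of $G$ whose restriction to $S$ is $\mathscr C_0$. The Sudoku number $sn(G)$ is the smallest $|S|$ such that $G[S]$ admits a Sudoku coloring of $G$. -}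

module Defs where

open import Data.Fin using (Fin)
open import Data.Fin.Subset using (Subset; _∈_; ∣_∣)
open import Data.Nat using (ℕ; _≤_)
open import Data.Product using (∃; ∃-syntax; ∃!; _×_; _,_; proj₁)
open import Function using (_on_)
open import Level using (0ℓ)
open import Relation.Binary using (Rel; Symmetric; Decidable)
open import Relation.Binary.Construct.Closure.ReflexiveTransitive using (Star)
open import Relation.Binary.PropositionalEquality using (_≡_; _≢_; _≗_)
open import Relation.Nullary using (¬_)
open import Relation.Unary using (Pred; _≐_)

record Graph (n : ℕ) : Set₁ where
  field
    Adj        : Rel (Fin n) 0ℓ
    adj-sym    : Symmetric Adj
    adj-irrefl : ∀ v → ¬ Adj v v
    adj?       : Decidable Adj

open Graph public

Connected : ∀ {n} → Graph n → Set
Connected G = ∀ u v → Star (Adj G) u v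

-- The vertex type is arbitrary so that this also covers induced subgraphs.
-- The colors 1, …, k are the elements of Fin k; not all need be used.
IsProper : {V : Set} → Rel V 0ℓ → ∀ {k} → (V → Fin k) → Set
IsProper E c = ∀ u v → E u v → c u ≢ c v

IsLeast : Pred ℕ 0ℓ → ℕ → Set
IsLeast P m = P m × (∀ j → P j → m ≤ j)

Colorable : ∀ {n} → Graph n → ℕ → Set
Colorable {n} G k = ∃[ c ] IsProper (Adj G) {k} c

IsChromaticNumber : ∀ {n} → Graph n → ℕ → Set
IsChromaticNumber G = IsLeast (Colorable G)

ColorClass : ∀ {n k} → (Fin n → Fin k) → Fin k → Pred (Fin n) 0ℓ
ColorClass c i v = c v ≡ i

-- Equality of the two families of color classes as sets of sets.  Both
-- colorings draw from the same k colors, so allowing empty classes makes no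
-- difference: equal families of nonempty classes leave equally many colors
-- unused.
SamePartition : ∀ {n k} → (c d : Fin n → Fin k) → Set
SamePartition c d =
    (∀ i → ∃[ j ] ColorClass c i ≐ ColorClass d j)
  × (∀ j → ∃[ i ] ColorClass d j ≐ ColorClass c i)

UniquelyColorable : ∀ {n} → Graph n → Set
UniquelyColorable {n} G =
  ∃[ k ] IsChromaticNumber G k
       × (∀ (c d : Fin n → Fin k) →
            IsProper (Adj G) c → IsProper (Adj G) d → SamePartition c d)

VertexIn : ∀ {n} → Subset n → Set
VertexIn S = ∃ (_∈ S)

InducedAdj : ∀ {n} → Graph n → (S : Subset n) → Rel (VertexIn S) 0ℓ
InducedAdj G S = Adj G on proj₁

Extends : ∀ {n k} {S : Subset n} → (Fin n → Fin k) → (VertexIn S → Fin k) → Set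
Extends c c₀ = ∀ v v∈S → c v ≡ c₀ (v , v∈S)

-- Here k is meant to be the chromatic number of G.  Colorings are functions,
-- so uniqueness is up to pointwise equality.
IsSudokuColoring : ∀ {n k} → Graph n → (S : Subset n) → (VertexIn S → Fin k) → Set
IsSudokuColoring G S c₀ =
    IsProper (InducedAdj G S) c₀
  × ∃! _≗_ (λ c → IsProper (Adj G) c × Extends {S = S} c c₀)

AdmitsSudokuColoring : ∀ {n} → Graph n → ℕ → Subset n → Set
AdmitsSudokuColoring G k S =
  ∃[ c₀ ] IsSudokuColoring {k = k} G S c₀

IsSudokuNumber : ∀ {n} → Graph n → ℕ → Set
IsSudokuNumber G s =
  ∃[ k ] IsChromaticNumber G k
       × IsLeast (λ m → ∃[ S ] ∣ S ∣ ≡ m × AdmitsSudokuColoring G k S) s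

{-# OPTIONS --safe #-}

-- A coloring of a uniquely colorable graph is determined by representatives of
-- all color classes but one: the remaining class must get the remaining color.
-- Conversely, if two colors a and b are missing on S, then exchanging a and b in
-- an extension gives a different extension, since every color is used by every
-- optimal coloring.
module Submission where

open import Defs
open import Data.Bool.Base using (true; false)
open import Data.Fin.Base using (Fin; zero; suc; punchIn; punchOut)
open import Data.Fin.Permutation.Components using (transpose; transpose-inverse)
open import Data.Fin.Properties
  using (_≟_; any?; 0≢1+n; suc-injective; punchIn-injective; punchInᵢ≢i;
         punchOut-injective)
open import Data.Fin.Subset using (Subset; _∈_; ∣_∣; _∪_; ⁅_⁆; ⊥; _-_)
open import Data.Fin.Subset.Properties
  using (_∈?_; x∈⁅x⁆; ∣⁅x⁆∣≡1; ∣⊥∣≡0; p⊆p∪q; q⊆p∪q; x∈p∧x≢y⇒x∈p-y; x∈p⇒∣p-x∣<∣p∣)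
open import Data.Nat using (ℕ; zero; suc; _+_; _∸_; _≤_; _≥_; z≤n; s≤s)
open import Data.Nat.Properties
  using (≤-reflexive; ≤-trans; ≤-antisym; +-suc; +-mono-≤; 1+n≰n; m≤n⇒m≤1+n)
open import Data.Product using (∃-syntax; _×_; _,_; proj₁; proj₂)
open import Data.Vec.Base using ([]; _∷_)
open import Function.Base using (_∘_)
open import Function.Definitions using (Injective)
open import Relation.Binary.PropositionalEquality
open import Relation.Nullary using (¬_; Dec; yes; no; contradiction)
open import Relation.Nullary.Decidable using (_×-dec_; ¬?; dec-true; dec-false; decidable-stable)

private
  variable
    k m n : ℕ

transpose-matchˡ : (i j : Fin n) → transpose i j i ≡ j
transpose-matchˡ i j rewrite dec-true (i ≟ i) refl = refl

transpose-mismatch : {i j l : Fin n} → l ≢ i → l ≢ j → transpose i j l ≡ l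
transpose-mismatch {i = i} {j} {l} l≢i l≢j
  rewrite dec-false (l ≟ i) l≢i | dec-false (l ≟ j) l≢j = refl

transpose-injective : (i j : Fin n) → Injective _≡_ _≡_ (transpose i j)
transpose-injective i j eq =
  trans (sym (transpose-inverse j i)) (trans (cong (transpose j i) eq) (transpose-inverse j i))

∣p∪q∣≤∣p∣+∣q∣ : (p q : Subset n) → ∣ p ∪ q ∣ ≤ ∣ p ∣ + ∣ q ∣
∣p∪q∣≤∣p∣+∣q∣ []          []          = z≤n
∣p∪q∣≤∣p∣+∣q∣ (false ∷ p) (false ∷ q) = ∣p∪q∣≤∣p∣+∣q∣ p q
∣p∪q∣≤∣p∣+∣q∣ (false ∷ p) (true  ∷ q) =
  ≤-trans (s≤s (∣p∪q∣≤∣p∣+∣q∣ p q)) (≤-reflexive (sym (+-suc ∣ p ∣ ∣ q ∣)))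
∣p∪q∣≤∣p∣+∣q∣ (true  ∷ p) (false ∷ q) = s≤s (∣p∪q∣≤∣p∣+∣q∣ p q)
∣p∪q∣≤∣p∣+∣q∣ (true  ∷ p) (true  ∷ q) =
  s≤s (≤-trans (m≤n⇒m≤1+n (∣p∪q∣≤∣p∣+∣q∣ p q)) (≤-reflexive (sym (+-suc ∣ p ∣ ∣ q ∣))))

image : (Fin m → Fin n) → Subset n
image {zero}  f = ⊥
image {suc m} f = ⁅ f zero ⁆ ∪ image (f ∘ suc)

∈-image : (f : Fin m → Fin n) (i : Fin m) → f i ∈ image f
∈-image f zero    = p⊆p∪q _ (x∈⁅x⁆ (f zero))
∈-image f (suc i) = q⊆p∪q ⁅ f zero ⁆ _ (∈-image (f ∘ suc) i)

∣image∣≤ : (f : Fin m → Fin n) → ∣ image f ∣ ≤ m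
∣image∣≤ {zero}  {n} f = ≤-reflexive (∣⊥∣≡0 n)
∣image∣≤ {suc m} {n} f =
  ≤-trans (∣p∪q∣≤∣p∣+∣q∣ ⁅ f zero ⁆ (image (f ∘ suc)))
          (+-mono-≤ (≤-reflexive (∣⁅x⁆∣≡1 (f zero))) (∣image∣≤ (f ∘ suc)))

-- Induction on `m`: removing `f zero` from `S` lowers its size, and by injectivity the remaining
-- values of `f` survive the removal.
injective⇒≤∣∣ : {f : Fin m → Fin n} {S : Subset n} →
                Injective _≡_ _≡_ f → (∀ i → f i ∈ S) → m ≤ ∣ S ∣
injective⇒≤∣∣ {zero}  inj f∈S = z≤n
injective⇒≤∣∣ {suc m} {f = f} {S} inj f∈S =
  ≤-trans (s≤s (injective⇒≤∣∣ {f = f ∘ suc} (suc-injective ∘ inj) f∘suc∈S-f0))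
          (x∈p⇒∣p-x∣<∣p∣ (f∈S zero))
  where
  f∘suc∈S-f0 : ∀ i → f (suc i) ∈ S - f zero
  f∘suc∈S-f0 i = x∈p∧x≢y⇒x∈p-y (f∈S (suc i)) (0≢1+n ∘ sym ∘ inj)

∣image∣≡ : {f : Fin m → Fin n} → Injective _≡_ _≡_ f → ∣ image f ∣ ≡ m
∣image∣≡ {f = f} inj = ≤-antisym (∣image∣≤ f) (injective⇒≤∣∣ inj (∈-image f))

IsProper-∘ : {V : Set} {E : V → V → Set} {c : V → Fin k} {f : Fin k → Fin m} →
             Injective _≡_ _≡_ f → IsProper E c → IsProper E (f ∘ c)
IsProper-∘ inj proper u v uv = proper u v uv ∘ inj

optimal⇒surjective : (G : Graph n) → IsChromaticNumber G k → {c : Fin n → Fin k} →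
                     IsProper (Adj G) c → ∀ i → ∃[ v ] c v ≡ i
optimal⇒surjective {k = suc k} G (_ , least) {c} proper i with any? (λ v → c v ≟ i)
... | yes hit = hit
... | no miss = contradiction (least k ((λ v → punchOut (i≢c v)) , proper′)) 1+n≰n
  where
  i≢c : ∀ v → i ≢ c v
  i≢c v eq = miss (v , sym eq)

  proper′ : IsProper (Adj G) (λ v → punchOut (i≢c v))
  proper′ u v uv = proper u v uv ∘ punchOut-injective (i≢c u) (i≢c v)

-- A class that the two partitions share is identified by the representative `r i` in it, so the
-- classes of `suc i` coincide for every `i`. Color `zero` has no representative and takes the
-- vertices left over.
SamePartition⇒≗ : {c d : Fin n → Fin (suc k)} (r : Fin k → Fin n) →
                  (∀ i → c (r i) ≡ suc i) → (∀ i → d (r i) ≡ suc i) →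
                  SamePartition c d → c ≗ d
SamePartition⇒≗ {c = c} {d} r cr dr (c⇒d , d⇒c) v with c v in cv | d v in dv
... | zero  | zero  = refl
-- An impossible case: the class of `suc j` under `d` contains both `v` and `r j`, so `c` agrees on
-- them. This chain is itself a proof of the goal `zero ≡ suc j`.
... | zero  | suc j =
  let i , (d⊆c , _) = d⇒c (suc j)
  in trans (sym cv) (trans (trans (d⊆c dv) (sym (d⊆c (dr j)))) (cr j))
... | suc i | _     =
  let j , (c⊆d , _) = c⇒d (suc i)
  in trans (sym (dr i)) (trans (trans (c⊆d (cr i)) (sym (c⊆d cv))) dv)

uniquelyColorable⇒samePartition :
  (G : Graph n) → UniquelyColorable G → IsChromaticNumber G k → {c d : Fin n → Fin k} →
  IsProper (Adj G) c → IsProper (Adj G) d → SamePartition c d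
uniquelyColorable⇒samePartition G (_ , (col , least) , unique) (col′ , least′)
  -- `UniquelyColorable` carries its own number of colors; two least elements are equal, so it can
  -- be identified with `k`.
  with ≤-antisym (least _ col′) (least′ _ col)
... | refl = unique _ _

representatives-admit :
  (G : Graph n) → UniquelyColorable G → IsChromaticNumber G (suc k) →
  ∃[ S ] ∣ S ∣ ≡ k × AdmitsSudokuColoring G (suc k) S
representatives-admit {k = k} G unique χ@((c , proper) , _) =
  image r , ∣image∣≡ r-injective , c ∘ proj₁ , (λ u v → proper (proj₁ u) (proj₁ v)) ,
  c , (proper , λ _ _ → refl) ,
  λ { (proper′ , extends) →
      SamePartition⇒≗ r cr (λ i → trans (extends (r i) (∈-image r i)) (cr i))
        (uniquelyColorable⇒samePartition G unique χ proper proper′) }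
  where
  -- Indexing by `suc i` leaves out exactly color `zero`, which gives `k` vertices for `suc k`
  -- colors.
  r : Fin k → Fin _
  r i = proj₁ (optimal⇒surjective G χ proper (suc i))

  cr : ∀ i → c (r i) ≡ suc i
  cr i = proj₂ (optimal⇒surjective G χ proper (suc i))

  r-injective : Injective _≡_ _≡_ r
  r-injective {i} {j} eq = suc-injective (trans (sym (cr i)) (trans (cong c eq) (cr j)))

-- All colors except possibly one occur on `S`. Picking a vertex of `S` for each of these `k` colors
-- is injective, because `c` tells the vertices apart.
admits⇒≤∣∣ : (G : Graph n) → IsChromaticNumber G (suc k) →
             (S : Subset n) → AdmitsSudokuColoring G (suc k) S → k ≤ ∣ S ∣
admits⇒≤∣∣ {n = n} {k} G χ S (c₀ , _ , c , (proper , extends) , unique) =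
  injective⇒≤∣∣ {f = λ j → proj₁ (seen j)}
    (λ {i} {j} eq → punchIn-injective a i j
      (trans (sym (proj₂ (proj₂ (seen i)))) (trans (cong c eq) (proj₂ (proj₂ (seen j))))))
    (λ j → proj₁ (proj₂ (seen j)))
  where
  Seen : Fin (suc k) → Set
  Seen i = ∃[ v ] v ∈ S × c v ≡ i

  seen? : ∀ i → Dec (Seen i)
  seen? i = any? λ v → (v ∈? S) ×-dec (c v ≟ i)

  -- No assumption `a ≢ b` is made: the exchanged coloring extends `c₀` in any case, hence equals
  -- `c`, and comparing both at a vertex of color `a` yields `a ≡ b`.
  unseen-unique : ∀ {a b} → ¬ Seen a → ¬ Seen b → a ≡ b
  unseen-unique {a} {b} ¬a ¬b = begin
    a                       ≡⟨ cv ⟨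
    c v                     ≡⟨ unique (proper′ , extends′) v ⟩
    transpose a b (c v)     ≡⟨ cong (transpose a b) cv ⟩
    transpose a b a         ≡⟨ transpose-matchˡ a b ⟩
    b                       ∎
    where
    open ≡-Reasoning

    v : Fin n
    v = proj₁ (optimal⇒surjective G χ proper a)

    cv : c v ≡ a
    cv = proj₂ (optimal⇒surjective G χ proper a)

    proper′ : IsProper (Adj G) (transpose a b ∘ c)
    proper′ = IsProper-∘ (transpose-injective a b) proper

    extends′ : Extends {S = S} (transpose a b ∘ c) c₀
    extends′ u u∈S =
      trans (transpose-mismatch (λ eq → ¬a (u , u∈S , eq)) (λ eq → ¬b (u , u∈S , eq)))
            (extends u u∈S)

  seen-except : ∃[ a ] (∀ j → Seen (punchIn a j))
  seen-except with any? (λ a → ¬? (seen? a))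
  ... | yes (a , ¬a) = a , λ j → decidable-stable (seen? _)
                             λ ¬j → punchInᵢ≢i a j (unseen-unique ¬j ¬a)
  -- Every color occurs on `S`, so the exception is arbitrary and `zero` serves.
  ... | no  ¬∃       = zero , λ j → decidable-stable (seen? _) λ ¬j → ¬∃ (_ , ¬j)

  a    = proj₁ seen-except
  seen = proj₂ seen-except

theorem3p3 : ∀ {n : ℕ} (G : Graph n) (t : ℕ) →
    Connected G → UniquelyColorable G →
    IsChromaticNumber G t → t ≥ 3 →
    IsSudokuNumber G (t ∸ 1)
-- The bound `t ≥ 3` excludes `zero`; on a successor, `∸ 1` reduces to the predecessor, which is the
-- `k` of both bounds.
theorem3p3 G (suc t) _ unique χ _ =
  suc t , χ , representatives-admit G unique χ , λ { _ (S , refl , admits) → admits⇒≤∣∣ G χ S admits }
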